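{- Let $P$ be the class of all finite Heyting algebras that are projective in the variety of all Heyting algebras. Then $(P;\leq)$ is well quasi-ordered, where $\mathbf{A}\leq\mathbf{B}$ means that $\mathbf{A}$ is isomorphic to a subalgebra of $\mathbf{B}$.
   Context: Heyting algebras are algebras $(A;\land,\lor,\to,\neg)$ with $(A;\land,\lor)$ a bounded distributive lattice, $\to$ the relative pseudocomplement and $\neg x=x\to\mathbf{0}$. An algebra $\mathbf{C}$ of a variety $\mathsf{V}$ is projective in $\mathsf{V}$ if for all $\mathbf{A}_1,\mathbf{A}_2\in\mathsf{V}$, every surjective homomorphism $h:\mathbf{A}_1\to\mathbf{A}_2$ and every homomorphism $f:\mathbf{C}\to\mathbf{A}_2$ there is a homomorphism $g:\mathbf{C}\to\mathbf{A}_1$ with $hg=f$. A quasi-ordered set is well quasi-ordered if every strictly decreasing sequence is finite and it contains no infinite antichain (set of pairwise incomparable elements). -}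

module Defs where

open import Level using (0ℓ)
open import Data.Nat using (ℕ; suc)
open import Data.Fin using (Fin)
open import Data.Product using (Σ; ∃; _×_; _,_)
open import Relation.Nullary using (¬_)
open import Relation.Binary.PropositionalEquality using (_≡_; _≢_)
open import Relation.Binary.Lattice.Bundles using (HeytingAlgebra)

HA : Set₁
HA = HeytingAlgebra 0ℓ 0ℓ 0ℓ

module _ (A : HA) where
  open HeytingAlgebra A

  neg : Carrier → Carrier
  neg x = x ⇨ ⊥

  Finite : Set
  Finite = Σ ℕ λ n → Σ (Fin n → Carrier) λ e →
             (∀ i j → e i ≈ e j → i ≡ j) × (∀ x → ∃ λ i → e i ≈ x)

module _ (A B : HA) where
  private
    module A = HeytingAlgebra A
    module B = HeytingAlgebra B

  record IsHom (f : A.Carrier → B.Carrier) : Set where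
    field
      cong  : ∀ {x y} → x A.≈ y → f x B.≈ f y
      ∧-hom : ∀ x y → f (x A.∧ y) B.≈ (f x B.∧ f y)
      ∨-hom : ∀ x y → f (x A.∨ y) B.≈ (f x B.∨ f y)
      ⇨-hom : ∀ x y → f (x A.⇨ y) B.≈ (f x B.⇨ f y)
      ¬-hom : ∀ x → f (neg A x) B.≈ neg B (f x)
      ⊤-hom : f A.⊤ B.≈ B.⊤
      ⊥-hom : f A.⊥ B.≈ B.⊥

  Hom : Set
  Hom = Σ (A.Carrier → B.Carrier) IsHom

  Surjective : (A.Carrier → B.Carrier) → Set
  Surjective f = ∀ y → ∃ λ x → f x B.≈ y

Projective : HA → Set₁
Projective C = ∀ (A₁ A₂ : HA) (h : Hom A₁ A₂) → Surjective A₁ A₂ (Data.Product.proj₁ h) →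
  (f : Hom C A₂) → Σ (Hom C A₁) λ g →
    ∀ x → HeytingAlgebra._≈_ A₂ (Data.Product.proj₁ h (Data.Product.proj₁ g x)) (Data.Product.proj₁ f x)

module _ (B : HA) where
  open HeytingAlgebra B

  record IsSubuniverse (S : Carrier → Set) : Set where
    field
      resp : ∀ {x y} → x ≈ y → S x → S y
      ∧-cl : ∀ {x y} → S x → S y → S (x ∧ y)
      ∨-cl : ∀ {x y} → S x → S y → S (x ∨ y)
      ⇨-cl : ∀ {x y} → S x → S y → S (x ⇨ y)
      ¬-cl : ∀ {x} → S x → S (neg B x)
      ⊤-cl : S ⊤
      ⊥-cl : S ⊥

_≲_ : HA → HA → Set₁
A ≲ B = Σ (HeytingAlgebra.Carrier B → Set) λ S → IsSubuniverse B S × Σ (Hom A B) λ f →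
  (∀ x → S (Data.Product.proj₁ f x)) ×
  (∀ x y → HeytingAlgebra._≈_ B (Data.Product.proj₁ f x) (Data.Product.proj₁ f y) → HeytingAlgebra._≈_ A x y) ×
  (∀ y → S y → ∃ λ x → HeytingAlgebra._≈_ B (Data.Product.proj₁ f x) y)

P : Set₁
P = Σ HA λ A → Finite A × Projective A

_≤P_ : P → P → Set₁
(A , _) ≤P (B , _) = A ≲ B

module _ {a r} {X : Set a} (_≤_ : X → X → Set r) where
  _<_ : X → X → Set r
  x < y = (x ≤ y) × ¬ (y ≤ x)

  Incomparable : X → X → Set r
  Incomparable x y = ¬ (x ≤ y) × ¬ (y ≤ x)

  WellQuasiOrdered : Set (a Level.⊔ r)
  WellQuasiOrdered =
    (¬ Σ (ℕ → X) λ f → ∀ n → f (suc n) < f n) ×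
    (¬ Σ (ℕ → X) λ f → ∀ i j → i ≢ j → Incomparable (f i) (f j))

{-# OPTIONS --safe #-}

-- Doubling the elements above c and using projectivity to split the resulting surjection shows
-- that for every c there is a join prime p ≥ c all of whose strict lower bounds lie below c.
-- Iterating this on two incomparable join primes climbs a Rieger–Nishimura ladder, so in a
-- finite algebra every join prime is incomparable to at most one other. Hence the algebra is an
-- ordinal sum of Boolean algebras with 2 and 4 elements, with the former on top, and is coded by
-- the non-empty list n₀, n₁, …, nₖ of lengths of the blocks of 4-element summands, counted from
-- the bottom. A 2-element summand embeds into any non-empty sum of summands, so the algebra
-- embeds into another one when n₀ ≤ m₀ and n₁ … nₖ is dominated by a sublist of m₁ … mₗ; by
-- Dickson's and Higman's lemmas this is a well-quasi-order.

module Submission where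

open import Defs
open import Level using (0ℓ)
open import Data.Bool.Base as Bool using (Bool; true; false; T)
open import Data.Bool.Properties using (T?; T-∧; T-∨)
open import Data.Empty using (⊥-elim) renaming (⊥ to 𝟘)
open import Data.Fin.Base using (Fin)
open import Data.Fin.Induction using (spo-wellFounded; spo-noetherian)
import Data.Fin.Properties as Fin
open import Data.List.Base using (List; []; _∷_; _++_)
open import Data.List.Properties using (++-identityʳ)
open import Data.List.Relation.Binary.Sublist.Heterogeneous
  using (Sublist; []; _∷_; _∷ʳ_) renaming (minimum to Sublist-minimum)
import Data.List.Relation.Binary.Sublist.Heterogeneous.Properties as Sublist
open import Data.List.Relation.Unary.All as All using (All; []; _∷_)
open import Data.List.Relation.Unary.All.Properties using (¬Any⇒All¬)
open import Data.List.Relation.Unary.Any using (Any; here; there; any?)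
open import Data.Nat.Base using (ℕ; zero; suc; z≤n; s≤s; _≤′_; ≤′-reflexive; ≤′-step)
  renaming (_≤_ to _≤ⁿ_; _<_ to _<ⁿ_)
open import Data.Nat.Induction using (<-rec)
import Data.Nat.Properties as ℕ
open import Data.Product using (Σ; ∃; ∃₂; _×_; _,_; proj₁; proj₂)
open import Data.Sum using (_⊎_; inj₁; inj₂; [_,_]′)
open import Data.Unit.Base using (tt)
open import Function.Base using (_∘_; _on_; id; flip)
open import Function.Bundles using (Equivalence)
open import Induction.WellFounded using (WellFounded; Acc; acc; module Subrelation)
import Relation.Binary.Construct.On as On
open import Relation.Binary.Core using (Rel)
open import Relation.Binary.Definitions using (_Respects_)
open import Relation.Binary.Lattice.Bundles using (HeytingAlgebra)
import Relation.Binary.Lattice.Properties.HeytingAlgebra as HeytingProperties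
import Relation.Binary.Lattice.Properties.JoinSemilattice as JoinProperties
import Relation.Binary.Lattice.Properties.MeetSemilattice as MeetProperties
open import Relation.Binary.PropositionalEquality as ≡ using (_≡_; _≢_; refl; cong; subst)
open import Relation.Binary.Structures using (IsStrictPartialOrder)
open import Relation.Nullary using (¬_; Dec; yes; no)
open import Relation.Nullary.Decidable
  using (map′; _×-dec_; _→-dec_; ¬?; ⌊_⌋; toWitness; fromWitness; decidable-stable)
open import Relation.Unary using (Decidable)

-- Almost full relations and Higman's lemma

⊎-merge : ∀ {A B C : Set} → C ⊎ A → C ⊎ B → C ⊎ A × B
⊎-merge (inj₁ c) _        = inj₁ c
⊎-merge (inj₂ a) (inj₁ c) = inj₁ c
⊎-merge (inj₂ a) (inj₂ b) = inj₂ (a , b)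

⊎-swapʳ : ∀ {A B C : Set} → (A ⊎ B) ⊎ C → (A ⊎ C) ⊎ B
⊎-swapʳ (inj₁ (inj₁ a)) = inj₁ (inj₁ a)
⊎-swapʳ (inj₁ (inj₂ b)) = inj₂ b
⊎-swapʳ (inj₂ c)        = inj₁ (inj₂ c)

-- Bar-inductive well-quasi-orders: every sequence (xₙ) provably has i < j with R xᵢ xⱼ.
data AlmostFull {X : Set} : Rel X 0ℓ → Set₁ where
  now   : ∀ {R} → (∀ x y → R x y) → AlmostFull R
  later : ∀ {R} → (∀ x → AlmostFull (λ y z → R y z ⊎ R x y)) → AlmostFull R

module _ {X : Set} where

  AF-mono : ∀ {R S : Rel X 0ℓ} → (∀ {x y} → R x y → S x y) → AlmostFull R → AlmostFull S
  AF-mono R⊆S (now r)   = now (λ x y → R⊆S (r x y))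
  AF-mono R⊆S (later k) =
    later (λ x → AF-mono [ inj₁ ∘ R⊆S , inj₂ ∘ R⊆S ]′ (k x))

  AF-on : ∀ {Y : Set} {R : Rel X 0ℓ} (f : Y → X) → AlmostFull R → AlmostFull (R on f)
  AF-on f (now r)   = now (λ x y → r (f x) (f y))
  AF-on f (later k) = later (λ y → AF-on f (k (f y)))

  good-pair : ∀ {R : Rel X 0ℓ} → AlmostFull R → (f : ℕ → X) →
              ∃₂ λ i j → i <ⁿ j × R (f i) (f j)
  good-pair (now r)   f = 0 , 1 , s≤s z≤n , r _ _
  good-pair (later k) f with good-pair (k (f 0)) (f ∘ suc)
  ... | i , j , i<j , inj₁ r = suc i , suc j , s≤s i<j , r
  ... | i , j , i<j , inj₂ r = 0 , suc i , s≤s z≤n , r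

  -- Coquand's proof of Ramsey's theorem: the binary case is reduced to the unary one, and this
  -- to the nullary one.
  AF-∩₀ : ∀ {R S C : Rel X 0ℓ} {A B : Set} → AlmostFull R → AlmostFull S →
          (∀ {x y} → R x y → C x y ⊎ A) → (∀ {x y} → S x y → C x y ⊎ B) →
          AlmostFull (λ x y → C x y ⊎ A × B)
  AF-∩₀ (now r) s R⊆ S⊆ = AF-mono (λ {x} {y} → ⊎-merge (R⊆ (r x y)) ∘ S⊆) s
  AF-∩₀ {C = C} (later k) s R⊆ S⊆ = later λ x →
    AF-mono [ [ inj₁ ∘ inj₁ , inj₂ ∘ inj₁ ]′ , inj₁ ∘ inj₂ ]′
      (AF-∩₀ {C = λ y z → C y z ⊎ C x y} (k x) s
        [ [ inj₁ ∘ inj₁ , inj₂ ]′ ∘ R⊆ , [ inj₁ ∘ inj₂ , inj₂ ]′ ∘ R⊆ ]′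
        ([ inj₁ ∘ inj₁ , inj₂ ]′ ∘ S⊆))

  AF-∩₁ : ∀ {R S C : Rel X 0ℓ} {A B : X → Set} → AlmostFull R → AlmostFull S →
          (∀ {x y} → R x y → C x y ⊎ A x) → (∀ {x y} → S x y → C x y ⊎ B x) →
          AlmostFull (λ x y → C x y ⊎ A x × B x)
  AF-∩₁ (now r) s R⊆ S⊆ = AF-mono (λ {x} {y} t → ⊎-merge (R⊆ (r x y)) (S⊆ t)) s
  AF-∩₁ r@(later _) (now s) R⊆ S⊆ = AF-mono (λ {x} {y} t → ⊎-merge (R⊆ t) (S⊆ (s x y))) r
  AF-∩₁ {C = C} {A} {B} r@(later k) s@(later l) R⊆ S⊆ = later λ x →
    AF-mono
      [ [ [ inj₁ ∘ inj₁ , inj₂ ∘ inj₁ ]′ , inj₁ ∘ inj₂ ]′ , inj₂ ∘ inj₂ ]′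
      -- Once `x` has been seen, each recursive call leaves one obligation, `A x` or `B x`, that no
      -- longer depends on later elements. The nullary case therefore intersects the two results.
      (AF-∩₀ {C = λ y z → (C y z ⊎ C x y) ⊎ A y × B y} {A = A x} {B = B x}
        (AF-∩₁ {C = λ y z → (C y z ⊎ C x y) ⊎ A x} {A} {B} (k x) s
          [ [ inj₁ ∘ inj₁ ∘ inj₁ , inj₂ ]′ ∘ R⊆
          , [ inj₁ ∘ inj₁ ∘ inj₂ , inj₁ ∘ inj₂ ]′ ∘ R⊆ ]′
          ([ inj₁ ∘ inj₁ ∘ inj₁ , inj₂ ]′ ∘ S⊆))
        (AF-∩₁ {C = λ y z → (C y z ⊎ C x y) ⊎ B x} {A} {B} r (l x)
          ([ inj₁ ∘ inj₁ ∘ inj₁ , inj₂ ]′ ∘ R⊆)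
          [ [ inj₁ ∘ inj₁ ∘ inj₁ , inj₂ ]′ ∘ S⊆
          , [ inj₁ ∘ inj₁ ∘ inj₂ , inj₁ ∘ inj₂ ]′ ∘ S⊆ ]′)
        ⊎-swapʳ ⊎-swapʳ)

  AF-∩₂ : ∀ {R S C A B : Rel X 0ℓ} → AlmostFull R → AlmostFull S →
          (∀ {x y} → R x y → C x y ⊎ A x y) → (∀ {x y} → S x y → C x y ⊎ B x y) →
          AlmostFull (λ x y → C x y ⊎ A x y × B x y)
  AF-∩₂ (now r) s R⊆ S⊆ = AF-mono (λ {x} {y} t → ⊎-merge (R⊆ (r x y)) (S⊆ t)) s
  AF-∩₂ r@(later _) (now s) R⊆ S⊆ = AF-mono (λ {x} {y} t → ⊎-merge (R⊆ t) (S⊆ (s x y))) r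
  AF-∩₂ {C = C} {A} {B} r@(later k) s@(later l) R⊆ S⊆ = later λ x →
    AF-mono
      [ [ [ inj₁ ∘ inj₁ , inj₂ ∘ inj₁ ]′ , inj₁ ∘ inj₂ ]′ , inj₂ ∘ inj₂ ]′
      -- With the first element `x` fixed, the leftover obligations `A x` and `B x` are unary, so
      -- the unary case combines the two calls.
      (AF-∩₁ {C = λ y z → (C y z ⊎ C x y) ⊎ A y z × B y z} {A = A x} {B = B x}
        (AF-∩₂ {C = λ y z → (C y z ⊎ C x y) ⊎ A x y} {A} {B} (k x) s
          [ [ inj₁ ∘ inj₁ ∘ inj₁ , inj₂ ]′ ∘ R⊆
          , [ inj₁ ∘ inj₁ ∘ inj₂ , inj₁ ∘ inj₂ ]′ ∘ R⊆ ]′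
          ([ inj₁ ∘ inj₁ ∘ inj₁ , inj₂ ]′ ∘ S⊆))
        (AF-∩₂ {C = λ y z → (C y z ⊎ C x y) ⊎ B x y} {A} {B} r (l x)
          ([ inj₁ ∘ inj₁ ∘ inj₁ , inj₂ ]′ ∘ R⊆)
          [ [ inj₁ ∘ inj₁ ∘ inj₁ , inj₂ ]′ ∘ S⊆
          , [ inj₁ ∘ inj₁ ∘ inj₂ , inj₁ ∘ inj₂ ]′ ∘ S⊆ ]′)
        ⊎-swapʳ ⊎-swapʳ)

AF-× : ∀ {X Y : Set} {R : Rel X 0ℓ} {S : Rel Y 0ℓ} → AlmostFull R → AlmostFull S →
       AlmostFull (λ p q → R (proj₁ p) (proj₁ q) × S (proj₂ p) (proj₂ q))
AF-× r s = AF-mono [ ⊥-elim , id ]′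
  (AF-∩₂ {C = λ _ _ → 𝟘} (AF-on proj₁ r) (AF-on proj₂ s) inj₂ inj₂)

AF-≤ : AlmostFull _≤ⁿ_
AF-≤ = later from
  where
  -- After `n` has occurred, only values below `n` still matter. A next value `x` above `n` is good
  -- with `n` at once; if `x ≤ n`, then `x` is below everything that is at least `n`, and the
  -- induction on `n` goes on.
  from : ∀ n → AlmostFull (λ y z → y ≤ⁿ z ⊎ n ≤ⁿ y)
  from zero    = now (λ _ _ → inj₂ z≤n)
  from (suc n) = later λ x → next x (n ℕ.<? x)
    where
    next : ∀ x → Dec (n <ⁿ x) →
           AlmostFull (λ y z → (y ≤ⁿ z ⊎ n <ⁿ y) ⊎ (x ≤ⁿ y ⊎ n <ⁿ x))
    next x (yes n<x) = now (λ _ _ → inj₂ (inj₂ n<x))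
    next x (no n≮x)  =
      AF-mono [ inj₁ ∘ inj₁ , inj₂ ∘ inj₁ ∘ ℕ.≤-trans (ℕ.≮⇒≥ n≮x) ]′ (from n)

-- Higman's lemma for lists of natural numbers

_≤*_ : Rel (List ℕ) 0ℓ
_≤*_ = Sublist _≤ⁿ_

Big : ℕ → List ℕ → Set
Big n = Any (n ≤ⁿ_)

-- A list with an entry at least `n` counts as good at once, so almost fullness of `Small n` is
-- Higman's lemma for lists with entries below `n`.
Small : ℕ → Rel (List ℕ) 0ℓ
Small n u v = Big n u ⊎ u ≤* v

-- In the second case the cut is at the first entry that is at least `b`.
data Split (b : ℕ) : List ℕ → Set where
  small : ∀ {u} → ¬ Big b u → Split b u
  split : ∀ u {x} v → ¬ Big b u → b ≤ⁿ x → Split b (u ++ x ∷ v)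

split? : ∀ b u → Split b u
split? b [] = small (λ ())
split? b (x ∷ u) with b ℕ.≤? x | split? b u
... | yes b≤x | _       = split [] u (λ ()) b≤x
... | no b≰x  | small s = small (λ { (here p) → b≰x p ; (there q) → s q })
... | no b≰x  | split u′ v s b≤y =
  split (x ∷ u′) v (λ { (here p) → b≰x p ; (there q) → s q }) b≤y

-- The components of a split, with a tag which is 0 when there is no large entry.
Code : Set
Code = List ℕ × ℕ × ℕ × List ℕ

code : ∀ {b u} → Split b u → Code
code (small {u} _)       = u , 0 , 0 , []
code (split u {x} v _ _) = u , 1 , x , v

-- A list avoiding b ∷ w consists of a list with entries below b and, possibly, an entry
-- followed by a list avoiding w.
AF-avoid : ∀ w → All (AlmostFull ∘ Small) w → AlmostFull (λ u v → w ≤* u ⊎ u ≤* v)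
AF-avoid []      _        = now (λ u _ → inj₁ (Sublist-minimum u))
AF-avoid (b ∷ w) (r ∷ rs) =
  AF-mono (λ {u} {v} → decode (split? b u) (split? b v))
    (AF-on (λ u → code (split? b u)) (AF-× r (AF-× AF-≤ (AF-× AF-≤ (AF-avoid w rs)))))
  where
  _≤ᶜ_ : Code → Code → Set
  (u , t , x , u′) ≤ᶜ (v , s , y , v′) =
    Small b u v × t ≤ⁿ s × x ≤ⁿ y × (w ≤* u′ ⊎ u′ ≤* v′)

  decode : ∀ {u v} (p : Split b u) (q : Split b v) → code p ≤ᶜ code q → (b ∷ w) ≤* u ⊎ u ≤* v
  decode (small s) _ (inj₁ t , _) = ⊥-elim (s t)
  decode (split _ _ s _) _ (inj₁ t , _) = ⊥-elim (s t)
  decode (small _) (small _) (inj₂ u≤v , _) = inj₂ u≤v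
  decode (small {u} _) (split v {y} v′ _ _) (inj₂ u≤v , _) =
    inj₂ (subst (_≤* (v ++ y ∷ v′)) (++-identityʳ u) (Sublist.++⁺ u≤v (Sublist-minimum _)))
  decode (split _ _ _ _) (small _) (inj₂ _ , () , _)
  -- The entry at the cut is at least `b` and `w` embeds in what follows it, so `b ∷ w` embeds in
  -- the whole list.
  decode (split u u′ _ b≤x) (split _ _ _ _) (inj₂ _ , _ , _ , inj₁ w≤u′) =
    inj₁ (Sublist.++ˡ u (b≤x ∷ w≤u′))
  decode (split _ _ _ _) (split _ _ _ _) (inj₂ u≤v , _ , x≤y , inj₂ u′≤v′) =
    inj₂ (Sublist.++⁺ u≤v (x≤y ∷ u′≤v′))

-- Strong induction on `n`. If the first list `w` has an entry at least `n`, it is good already.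
-- Otherwise all its entries `b` are below `n`, and the induction hypotheses for `Small b` are what
-- `AF-avoid` asks for.
AF-Small : ∀ n → AlmostFull (Small n)
AF-Small = <-rec _ λ n rec → later λ w → step rec w (any? (n ℕ.≤?_) w)
  where
  step : ∀ {n} → (∀ {m} → m <ⁿ n → AlmostFull (Small m)) → ∀ w → Dec (Big n w) →
         AlmostFull (λ u v → Small n u v ⊎ Small n w u)
  step rec w (yes big) = now (λ _ _ → inj₂ (inj₁ big))
  step rec w (no ¬big) = AF-mono [ inj₂ ∘ inj₂ , inj₁ ∘ inj₂ ]′
    (AF-avoid w (All.map (λ n≰b → rec (ℕ.≰⇒> n≰b)) (¬Any⇒All¬ w ¬big)))

-- Higman's lemma: the lists after the first one, `w`, either lie above `w` or avoid it, and the
-- avoiding ones are controlled by `AF-avoid`.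
AF-≤* : AlmostFull _≤*_
AF-≤* = later λ w → AF-mono [ inj₂ , inj₁ ]′ (AF-avoid w (All.universal AF-Small w))

-- Ordinal sums of Boolean algebras

data Layer : Set where
  one two : Layer

Word : Set
Word = List Layer

infix 4 _≤ᵀ_
infixr 7 _∧ᵀ_
infixr 6 _∨ᵀ_
infixr 5 _⇨ᵀ_

-- The ordinal sum of Boolean algebras with 2 (for one) or 4 (for two) elements, listed from
-- the bottom; the top of each summand is identified with the bottom of the next one.
data Tower : Word → Set where
  top : Tower []
  bot : ∀ {l w} → Tower (l ∷ w)
  lft : ∀ {w} → Tower (two ∷ w)
  rgt : ∀ {w} → Tower (two ∷ w)
  up  : ∀ {l w} → Tower w → Tower (l ∷ w)

data _≤ᵀ_ : ∀ {w} → Rel (Tower w) 0ℓ where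
  top≤top : top ≤ᵀ top
  bot≤    : ∀ {l w} {x : Tower (l ∷ w)} → bot ≤ᵀ x
  lft≤lft : ∀ {w} → lft {w} ≤ᵀ lft
  rgt≤rgt : ∀ {w} → rgt {w} ≤ᵀ rgt
  lft≤up  : ∀ {w} {x : Tower w} → lft ≤ᵀ up x
  rgt≤up  : ∀ {w} {x : Tower w} → rgt ≤ᵀ up x
  up≤up   : ∀ {l w} {x y : Tower w} → x ≤ᵀ y → up {l} x ≤ᵀ up y

⊤ᵀ : ∀ {w} → Tower w
⊤ᵀ {[]}    = top
⊤ᵀ {_ ∷ _} = up ⊤ᵀ

⊥ᵀ : ∀ {w} → Tower w
⊥ᵀ {[]}    = top
⊥ᵀ {_ ∷ _} = bot

_∧ᵀ_ : ∀ {w} → Tower w → Tower w → Tower w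
top  ∧ᵀ top  = top
bot  ∧ᵀ _    = bot
lft  ∧ᵀ bot  = bot
lft  ∧ᵀ lft  = lft
lft  ∧ᵀ rgt  = bot
lft  ∧ᵀ up _ = lft
rgt  ∧ᵀ bot  = bot
rgt  ∧ᵀ lft  = bot
rgt  ∧ᵀ rgt  = rgt
rgt  ∧ᵀ up _ = rgt
up _ ∧ᵀ bot  = bot
up _ ∧ᵀ lft  = lft
up _ ∧ᵀ rgt  = rgt
up x ∧ᵀ up y = up (x ∧ᵀ y)

_∨ᵀ_ : ∀ {w} → Tower w → Tower w → Tower w
top  ∨ᵀ top  = top
bot  ∨ᵀ y    = y
lft  ∨ᵀ bot  = lft
lft  ∨ᵀ lft  = lft
lft  ∨ᵀ rgt  = up ⊥ᵀ
lft  ∨ᵀ up y = up y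
rgt  ∨ᵀ bot  = rgt
rgt  ∨ᵀ lft  = up ⊥ᵀ
rgt  ∨ᵀ rgt  = rgt
rgt  ∨ᵀ up y = up y
up x ∨ᵀ bot  = up x
up x ∨ᵀ lft  = up x
up x ∨ᵀ rgt  = up x
up x ∨ᵀ up y = up (x ∨ᵀ y)

-- For `x ≤ y` the value is the top of the whole tower. Otherwise it is the Boolean implication if
-- both arguments lie in one summand, and `y` if `y` lies in a lower one.
_⇨ᵀ_ : ∀ {w} → Tower w → Tower w → Tower w
top  ⇨ᵀ top  = top
bot  ⇨ᵀ _    = ⊤ᵀ
lft  ⇨ᵀ bot  = rgt
lft  ⇨ᵀ lft  = ⊤ᵀ
lft  ⇨ᵀ rgt  = rgt
lft  ⇨ᵀ up _ = ⊤ᵀ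
rgt  ⇨ᵀ bot  = lft
rgt  ⇨ᵀ lft  = lft
rgt  ⇨ᵀ rgt  = ⊤ᵀ
rgt  ⇨ᵀ up _ = ⊤ᵀ
up _ ⇨ᵀ bot  = bot
up _ ⇨ᵀ lft  = lft
up _ ⇨ᵀ rgt  = rgt
up x ⇨ᵀ up y = up (x ⇨ᵀ y)

≤ᵀ-refl : ∀ {w} (x : Tower w) → x ≤ᵀ x
≤ᵀ-refl top    = top≤top
≤ᵀ-refl bot    = bot≤
≤ᵀ-refl lft    = lft≤lft
≤ᵀ-refl rgt    = rgt≤rgt
≤ᵀ-refl (up x) = up≤up (≤ᵀ-refl x)

≤ᵀ-reflexive : ∀ {w} {x y : Tower w} → x ≡ y → x ≤ᵀ y
≤ᵀ-reflexive refl = ≤ᵀ-refl _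

≤ᵀ-trans : ∀ {w} {x y z : Tower w} → x ≤ᵀ y → y ≤ᵀ z → x ≤ᵀ z
≤ᵀ-trans top≤top   q         = q
≤ᵀ-trans bot≤      _         = bot≤
≤ᵀ-trans lft≤lft   q         = q
≤ᵀ-trans rgt≤rgt   q         = q
≤ᵀ-trans lft≤up    (up≤up _) = lft≤up
≤ᵀ-trans rgt≤up    (up≤up _) = rgt≤up
≤ᵀ-trans (up≤up p) (up≤up q) = up≤up (≤ᵀ-trans p q)

≤ᵀ-antisym : ∀ {w} {x y : Tower w} → x ≤ᵀ y → y ≤ᵀ x → x ≡ y
≤ᵀ-antisym top≤top   _         = refl
≤ᵀ-antisym bot≤      bot≤      = refl
≤ᵀ-antisym lft≤lft   _         = refl
≤ᵀ-antisym rgt≤rgt   _         = refl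
≤ᵀ-antisym (up≤up p) (up≤up q) = cong up (≤ᵀ-antisym p q)

⊤ᵀ-maximum : ∀ {w} (x : Tower w) → x ≤ᵀ ⊤ᵀ
⊤ᵀ-maximum top    = top≤top
⊤ᵀ-maximum bot    = bot≤
⊤ᵀ-maximum lft    = lft≤up
⊤ᵀ-maximum rgt    = rgt≤up
⊤ᵀ-maximum (up x) = up≤up (⊤ᵀ-maximum x)

⊥ᵀ-minimum : ∀ {w} (x : Tower w) → ⊥ᵀ ≤ᵀ x
⊥ᵀ-minimum {[]}    top = top≤top
⊥ᵀ-minimum {_ ∷ _} _   = bot≤

∧ᵀ-comm : ∀ {w} (x y : Tower w) → x ∧ᵀ y ≡ y ∧ᵀ x
∧ᵀ-comm top    top    = refl
∧ᵀ-comm bot    bot    = refl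
∧ᵀ-comm bot    lft    = refl
∧ᵀ-comm bot    rgt    = refl
∧ᵀ-comm bot    (up _) = refl
∧ᵀ-comm lft    bot    = refl
∧ᵀ-comm lft    lft    = refl
∧ᵀ-comm lft    rgt    = refl
∧ᵀ-comm lft    (up _) = refl
∧ᵀ-comm rgt    bot    = refl
∧ᵀ-comm rgt    lft    = refl
∧ᵀ-comm rgt    rgt    = refl
∧ᵀ-comm rgt    (up _) = refl
∧ᵀ-comm (up _) bot    = refl
∧ᵀ-comm (up _) lft    = refl
∧ᵀ-comm (up _) rgt    = refl
∧ᵀ-comm (up x) (up y) = cong up (∧ᵀ-comm x y)

x∧ᵀy≤x : ∀ {w} (x y : Tower w) → x ∧ᵀ y ≤ᵀ x
x∧ᵀy≤x top    top    = top≤top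
x∧ᵀy≤x bot    _      = bot≤
x∧ᵀy≤x lft    bot    = bot≤
x∧ᵀy≤x lft    lft    = lft≤lft
x∧ᵀy≤x lft    rgt    = bot≤
x∧ᵀy≤x lft    (up _) = lft≤lft
x∧ᵀy≤x rgt    bot    = bot≤
x∧ᵀy≤x rgt    lft    = bot≤
x∧ᵀy≤x rgt    rgt    = rgt≤rgt
x∧ᵀy≤x rgt    (up _) = rgt≤rgt
x∧ᵀy≤x (up _) bot    = bot≤
x∧ᵀy≤x (up _) lft    = lft≤up
x∧ᵀy≤x (up _) rgt    = rgt≤up
x∧ᵀy≤x (up x) (up y) = up≤up (x∧ᵀy≤x x y)

x∧ᵀy≤y : ∀ {w} (x y : Tower w) → x ∧ᵀ y ≤ᵀ y
x∧ᵀy≤y x y = subst (_≤ᵀ y) (∧ᵀ-comm y x) (x∧ᵀy≤x y x)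

∧ᵀ-greatest : ∀ {w} {x y z : Tower w} → z ≤ᵀ x → z ≤ᵀ y → z ≤ᵀ x ∧ᵀ y
∧ᵀ-greatest top≤top   top≤top   = top≤top
∧ᵀ-greatest bot≤      _         = bot≤
∧ᵀ-greatest lft≤lft   lft≤lft   = lft≤lft
∧ᵀ-greatest lft≤lft   lft≤up    = lft≤lft
∧ᵀ-greatest rgt≤rgt   rgt≤rgt   = rgt≤rgt
∧ᵀ-greatest rgt≤rgt   rgt≤up    = rgt≤rgt
∧ᵀ-greatest lft≤up    lft≤lft   = lft≤lft
∧ᵀ-greatest lft≤up    lft≤up    = lft≤up
∧ᵀ-greatest rgt≤up    rgt≤rgt   = rgt≤rgt
∧ᵀ-greatest rgt≤up    rgt≤up    = rgt≤up
∧ᵀ-greatest (up≤up p) (up≤up q) = up≤up (∧ᵀ-greatest p q)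

∨ᵀ-comm : ∀ {w} (x y : Tower w) → x ∨ᵀ y ≡ y ∨ᵀ x
∨ᵀ-comm top    top    = refl
∨ᵀ-comm bot    bot    = refl
∨ᵀ-comm bot    lft    = refl
∨ᵀ-comm bot    rgt    = refl
∨ᵀ-comm bot    (up _) = refl
∨ᵀ-comm lft    bot    = refl
∨ᵀ-comm lft    lft    = refl
∨ᵀ-comm lft    rgt    = refl
∨ᵀ-comm lft    (up _) = refl
∨ᵀ-comm rgt    bot    = refl
∨ᵀ-comm rgt    lft    = refl
∨ᵀ-comm rgt    rgt    = refl
∨ᵀ-comm rgt    (up _) = refl
∨ᵀ-comm (up _) bot    = refl
∨ᵀ-comm (up _) lft    = refl
∨ᵀ-comm (up _) rgt    = refl
∨ᵀ-comm (up x) (up y) = cong up (∨ᵀ-comm x y)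

x≤x∨ᵀy : ∀ {w} (x y : Tower w) → x ≤ᵀ x ∨ᵀ y
x≤x∨ᵀy top    top    = top≤top
x≤x∨ᵀy bot    _      = bot≤
x≤x∨ᵀy lft    bot    = lft≤lft
x≤x∨ᵀy lft    lft    = lft≤lft
x≤x∨ᵀy lft    rgt    = lft≤up
x≤x∨ᵀy lft    (up _) = lft≤up
x≤x∨ᵀy rgt    bot    = rgt≤rgt
x≤x∨ᵀy rgt    lft    = rgt≤up
x≤x∨ᵀy rgt    rgt    = rgt≤rgt
x≤x∨ᵀy rgt    (up _) = rgt≤up
x≤x∨ᵀy (up _) bot    = ≤ᵀ-refl _
x≤x∨ᵀy (up _) lft    = ≤ᵀ-refl _
x≤x∨ᵀy (up _) rgt    = ≤ᵀ-refl _
x≤x∨ᵀy (up x) (up y) = up≤up (x≤x∨ᵀy x y)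

y≤x∨ᵀy : ∀ {w} (x y : Tower w) → y ≤ᵀ x ∨ᵀ y
y≤x∨ᵀy x y = subst (y ≤ᵀ_) (∨ᵀ-comm y x) (x≤x∨ᵀy y x)

∨ᵀ-least : ∀ {w} {x y z : Tower w} → x ≤ᵀ z → y ≤ᵀ z → x ∨ᵀ y ≤ᵀ z
∨ᵀ-least top≤top   top≤top   = top≤top
∨ᵀ-least bot≤      q         = q
∨ᵀ-least lft≤lft   bot≤      = lft≤lft
∨ᵀ-least lft≤lft   lft≤lft   = lft≤lft
∨ᵀ-least rgt≤rgt   bot≤      = rgt≤rgt
∨ᵀ-least rgt≤rgt   rgt≤rgt   = rgt≤rgt
∨ᵀ-least lft≤up    bot≤      = lft≤up
∨ᵀ-least lft≤up    lft≤up    = lft≤up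
∨ᵀ-least lft≤up    rgt≤up    = up≤up (⊥ᵀ-minimum _)
∨ᵀ-least lft≤up    (up≤up q) = up≤up q
∨ᵀ-least rgt≤up    bot≤      = rgt≤up
∨ᵀ-least rgt≤up    lft≤up    = up≤up (⊥ᵀ-minimum _)
∨ᵀ-least rgt≤up    rgt≤up    = rgt≤up
∨ᵀ-least rgt≤up    (up≤up q) = up≤up q
∨ᵀ-least (up≤up p) bot≤      = up≤up p
∨ᵀ-least (up≤up p) lft≤up    = up≤up p
∨ᵀ-least (up≤up p) rgt≤up    = up≤up p
∨ᵀ-least (up≤up p) (up≤up q) = up≤up (∨ᵀ-least p q)

⇨ᵀ-intro : ∀ {w} (z x y : Tower w) → z ∧ᵀ x ≤ᵀ y → z ≤ᵀ x ⇨ᵀ y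
⇨ᵀ-intro top    top    top    _         = top≤top
⇨ᵀ-intro bot    _      _      _         = bot≤
⇨ᵀ-intro z      bot    _      _         = ⊤ᵀ-maximum z
⇨ᵀ-intro z      lft    lft    _         = ⊤ᵀ-maximum z
⇨ᵀ-intro z      lft    (up _) _         = ⊤ᵀ-maximum z
⇨ᵀ-intro z      rgt    rgt    _         = ⊤ᵀ-maximum z
⇨ᵀ-intro z      rgt    (up _) _         = ⊤ᵀ-maximum z
⇨ᵀ-intro rgt    lft    bot    _         = rgt≤rgt
⇨ᵀ-intro rgt    lft    rgt    _         = rgt≤rgt
⇨ᵀ-intro lft    rgt    bot    _         = lft≤lft
⇨ᵀ-intro lft    rgt    lft    _         = lft≤lft
⇨ᵀ-intro lft    (up _) lft    _         = lft≤lft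
⇨ᵀ-intro lft    (up _) (up _) _         = lft≤up
⇨ᵀ-intro rgt    (up _) rgt    _         = rgt≤rgt
⇨ᵀ-intro rgt    (up _) (up _) _         = rgt≤up
⇨ᵀ-intro (up z) (up x) (up y) (up≤up p) = up≤up (⇨ᵀ-intro z x y p)

⇨ᵀ-elim : ∀ {w} (x y : Tower w) → (x ⇨ᵀ y) ∧ᵀ x ≤ᵀ y
⇨ᵀ-elim top    top    = top≤top
⇨ᵀ-elim bot    _      = bot≤
⇨ᵀ-elim lft    bot    = bot≤
⇨ᵀ-elim lft    lft    = lft≤lft
⇨ᵀ-elim lft    rgt    = bot≤
⇨ᵀ-elim lft    (up _) = lft≤up
⇨ᵀ-elim rgt    bot    = bot≤
⇨ᵀ-elim rgt    lft    = bot≤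
⇨ᵀ-elim rgt    rgt    = rgt≤rgt
⇨ᵀ-elim rgt    (up _) = rgt≤up
⇨ᵀ-elim (up _) bot    = bot≤
⇨ᵀ-elim (up _) lft    = lft≤lft
⇨ᵀ-elim (up _) rgt    = rgt≤rgt
⇨ᵀ-elim (up x) (up y) = up≤up (⇨ᵀ-elim x y)

tower : Word → HA
tower w = record
  { Carrier = Tower w
  ; _≈_     = _≡_
  ; _≤_     = _≤ᵀ_
  ; _∨_     = _∨ᵀ_
  ; _∧_     = _∧ᵀ_
  ; _⇨_     = _⇨ᵀ_
  ; ⊤       = ⊤ᵀ
  ; ⊥       = ⊥ᵀ
  ; isHeytingAlgebra = record
    { isBoundedLattice = record
      { isLattice = record
        { isPartialOrder = record
          { isPreorder = record
            { isEquivalence = ≡.isEquivalence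
            ; reflexive     = ≤ᵀ-reflexive
            ; trans         = ≤ᵀ-trans
            }
          ; antisym = ≤ᵀ-antisym
          }
        ; supremum = λ x y → x≤x∨ᵀy x y , y≤x∨ᵀy x y , λ _ → ∨ᵀ-least
        ; infimum  = λ x y → x∧ᵀy≤x x y , x∧ᵀy≤y x y , λ _ → ∧ᵀ-greatest
        }
      ; maximum = ⊤ᵀ-maximum
      ; minimum = ⊥ᵀ-minimum
      }
    ; exponential = λ z x y → ⇨ᵀ-intro z x y , λ z≤x⇨y →
        ≤ᵀ-trans (∧ᵀ-greatest (≤ᵀ-trans (x∧ᵀy≤x z x) z≤x⇨y) (x∧ᵀy≤y z x)) (⇨ᵀ-elim x y)
    }
  }

-- A summand with two elements may absorb any non-empty block of summands.
data _⊑_ : Word → Word → Set where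
  []   : [] ⊑ []
  keep : ∀ {w v} → w ⊑ v → (two ∷ w) ⊑ (two ∷ v)
  one  : ∀ {l w v} → w ⊑ v → (one ∷ w) ⊑ (l ∷ v)
  skip : ∀ {l w v} → (one ∷ w) ⊑ v → (one ∷ w) ⊑ (l ∷ v)

-- When a two-element summand absorbs a block, `bot` goes to the bottom of the block and everything
-- above `bot` goes past the whole block. Implications from there down to `bot` still give `bot`, as
-- they do in the source.
embed : ∀ {w v} → w ⊑ v → Tower w → Tower v
embed []       top    = top
embed (keep e) bot    = bot
embed (keep e) lft    = lft
embed (keep e) rgt    = rgt
embed (keep e) (up x) = up (embed e x)
embed (one e)  bot    = bot
embed (one e)  (up x) = up (embed e x)
embed (skip e) bot    = bot
embed (skip e) (up x) = up (embed e (up x))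

embed-⊤ : ∀ {w v} (e : w ⊑ v) → embed e ⊤ᵀ ≡ ⊤ᵀ
embed-⊤ []       = refl
embed-⊤ (keep e) = cong up (embed-⊤ e)
embed-⊤ (one e)  = cong up (embed-⊤ e)
embed-⊤ (skip e) = cong up (embed-⊤ e)

embed-⊥ : ∀ {w v} (e : w ⊑ v) → embed e ⊥ᵀ ≡ ⊥ᵀ
embed-⊥ []       = refl
embed-⊥ (keep e) = refl
embed-⊥ (one e)  = refl
embed-⊥ (skip e) = refl

embed-∧ : ∀ {w v} (e : w ⊑ v) x y → embed e (x ∧ᵀ y) ≡ embed e x ∧ᵀ embed e y
embed-∧ []       top    top    = refl
embed-∧ (keep e) bot    _      = refl
embed-∧ (keep e) lft    bot    = refl
embed-∧ (keep e) lft    lft    = refl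
embed-∧ (keep e) lft    rgt    = refl
embed-∧ (keep e) lft    (up _) = refl
embed-∧ (keep e) rgt    bot    = refl
embed-∧ (keep e) rgt    lft    = refl
embed-∧ (keep e) rgt    rgt    = refl
embed-∧ (keep e) rgt    (up _) = refl
embed-∧ (keep e) (up _) bot    = refl
embed-∧ (keep e) (up _) lft    = refl
embed-∧ (keep e) (up _) rgt    = refl
embed-∧ (keep e) (up x) (up y) = cong up (embed-∧ e x y)
embed-∧ (one e)  bot    _      = refl
embed-∧ (one e)  (up _) bot    = refl
embed-∧ (one e)  (up x) (up y) = cong up (embed-∧ e x y)
embed-∧ (skip e) bot    _      = refl
embed-∧ (skip e) (up _) bot    = refl
embed-∧ (skip e) (up x) (up y) = cong up (embed-∧ e (up x) (up y))

embed-∨ : ∀ {w v} (e : w ⊑ v) x y → embed e (x ∨ᵀ y) ≡ embed e x ∨ᵀ embed e y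
embed-∨ []       top    top    = refl
embed-∨ (keep e) bot    _      = refl
embed-∨ (keep e) lft    bot    = refl
embed-∨ (keep e) lft    lft    = refl
embed-∨ (keep e) lft    rgt    = cong up (embed-⊥ e)
embed-∨ (keep e) lft    (up _) = refl
embed-∨ (keep e) rgt    bot    = refl
embed-∨ (keep e) rgt    lft    = cong up (embed-⊥ e)
embed-∨ (keep e) rgt    rgt    = refl
embed-∨ (keep e) rgt    (up _) = refl
embed-∨ (keep e) (up _) bot    = refl
embed-∨ (keep e) (up _) lft    = refl
embed-∨ (keep e) (up _) rgt    = refl
embed-∨ (keep e) (up x) (up y) = cong up (embed-∨ e x y)
embed-∨ (one e)  bot    _      = refl
embed-∨ (one e)  (up _) bot    = refl
embed-∨ (one e)  (up x) (up y) = cong up (embed-∨ e x y)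
embed-∨ (skip e) bot    _      = refl
embed-∨ (skip e) (up _) bot    = refl
embed-∨ (skip e) (up x) (up y) = cong up (embed-∨ e (up x) (up y))

embed-⇨ : ∀ {w v} (e : w ⊑ v) x y → embed e (x ⇨ᵀ y) ≡ embed e x ⇨ᵀ embed e y
embed-⇨ []       top    top    = refl
embed-⇨ (keep e) bot    _      = cong up (embed-⊤ e)
embed-⇨ (keep e) lft    bot    = refl
embed-⇨ (keep e) lft    lft    = cong up (embed-⊤ e)
embed-⇨ (keep e) lft    rgt    = refl
embed-⇨ (keep e) lft    (up _) = cong up (embed-⊤ e)
embed-⇨ (keep e) rgt    bot    = refl
embed-⇨ (keep e) rgt    lft    = refl
embed-⇨ (keep e) rgt    rgt    = cong up (embed-⊤ e)
embed-⇨ (keep e) rgt    (up _) = cong up (embed-⊤ e)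
embed-⇨ (keep e) (up _) bot    = refl
embed-⇨ (keep e) (up _) lft    = refl
embed-⇨ (keep e) (up _) rgt    = refl
embed-⇨ (keep e) (up x) (up y) = cong up (embed-⇨ e x y)
embed-⇨ (one e)  bot    _      = cong up (embed-⊤ e)
embed-⇨ (one e)  (up _) bot    = refl
embed-⇨ (one e)  (up x) (up y) = cong up (embed-⇨ e x y)
embed-⇨ (skip e) bot    _      = cong up (embed-⊤ e)
embed-⇨ (skip e) (up _) bot    = refl
embed-⇨ (skip e) (up x) (up y) = cong up (embed-⇨ e (up x) (up y))

up-injective : ∀ {l w} {x y : Tower w} → up {l} x ≡ up y → x ≡ y
up-injective refl = refl

embed-injective : ∀ {w v} (e : w ⊑ v) x y → embed e x ≡ embed e y → x ≡ y
embed-injective []       top    top    _  = refl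
embed-injective (keep e) bot    bot    _  = refl
embed-injective (keep e) lft    lft    _  = refl
embed-injective (keep e) rgt    rgt    _  = refl
embed-injective (keep e) (up x) (up y) eq = cong up (embed-injective e x y (up-injective eq))
embed-injective (one e)  bot    bot    _  = refl
embed-injective (one e)  (up x) (up y) eq = cong up (embed-injective e x y (up-injective eq))
embed-injective (skip e) bot    bot    _  = refl
embed-injective (skip e) (up x) (up y) eq = embed-injective e (up x) (up y) (up-injective eq)

embed-isHom : ∀ {w v} (e : w ⊑ v) → IsHom (tower w) (tower v) (embed e)
embed-isHom e = record
  { cong  = cong (embed e)
  ; ∧-hom = embed-∧ e
  ; ∨-hom = embed-∨ e
  ; ⇨-hom = embed-⇨ e
  ; ¬-hom = λ x → ≡.trans (embed-⇨ e x ⊥ᵀ) (cong (embed e x ⇨ᵀ_) (embed-⊥ e))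
  ; ⊤-hom = embed-⊤ e
  ; ⊥-hom = embed-⊥ e
  }

-- The words ending in one, cut after each occurrence of one: the entries count the letters
-- two in front of it.
word : ℕ → List ℕ → Word
word zero    []       = one ∷ []
word zero    (n ∷ ns) = one ∷ word n ns
word (suc n) ns       = two ∷ word n ns

one⊑word : ∀ n ns → (one ∷ []) ⊑ word n ns
one⊑word zero    []       = one []
one⊑word zero    (n ∷ ns) = skip (one⊑word n ns)
one⊑word (suc n) ns       = skip (one⊑word n ns)

-- The `one` closing a matched block absorbs the surplus letters `two` of its partner, the partner's
-- own `one` and the blocks skipped before the next match; the last `one` absorbs all that is left.
-- No `one` precedes the first block, so its length is compared directly.
word-⊑ : ∀ {n m ns ms} → n ≤ⁿ m → ns ≤* ms → word n ns ⊑ word m ms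
word-⊑ {m = m}     {[]}    {ms} z≤n _ = one⊑word m ms
word-⊑ {m = suc _} {_ ∷ _} z≤n s = skip (word-⊑ z≤n s)
word-⊑ {m = zero}  {_ ∷ _} z≤n (m′ ∷ʳ s) = skip (word-⊑ {m = m′} z≤n s)
word-⊑ {m = zero}  {_ ∷ _} z≤n (n≤m ∷ s) = one (word-⊑ n≤m s)
word-⊑ (s≤s n≤m) s = keep (word-⊑ n≤m s)

-- Finite projective Heyting algebras

module FiniteHeyting (A : HA) (finite : Finite A) where
  open HeytingAlgebra A renaming (refl to ≤-refl)
  open HeytingProperties A using (∧-distribˡ-∨-≤)

  private
    size = proj₁ finite
    enum = proj₁ (proj₂ finite)

    index : Carrier → Fin size
    index x = proj₁ (proj₂ (proj₂ (proj₂ finite)) x)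

    enum-index : ∀ x → enum (index x) ≈ x
    enum-index x = proj₂ (proj₂ (proj₂ (proj₂ finite)) x)

  infix 4 _≈?_ _≤?_ _⊏_

  _≈?_ : ∀ x y → Dec (x ≈ y)
  x ≈? y = map′
    (λ eq → Eq.trans (Eq.sym (enum-index x))
      (Eq.trans (Eq.reflexive (cong enum eq)) (enum-index y)))
    (λ x≈y → proj₁ (proj₂ (proj₂ finite)) _ _
      (Eq.trans (enum-index x) (Eq.trans x≈y (Eq.sym (enum-index y)))))
    (index x Fin.≟ index y)

  _≤?_ : ∀ x y → Dec (x ≤ y)
  _≤?_ = MeetProperties.≈-dec⇒≤-dec meetSemilattice _≈?_

  ∃? : ∀ {Q : Carrier → Set} → Q Respects _≈_ → Decidable Q → Dec (∃ Q)
  ∃? resp Q? = map′ (λ (i , q) → enum i , q)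
    (λ (x , q) → index x , resp (Eq.sym (enum-index x)) q) (Fin.any? (Q? ∘ enum))

  ≤-respˡ : ∀ {x y z} → x ≈ y → x ≤ z → y ≤ z
  ≤-respˡ x≈y = trans (reflexive (Eq.sym x≈y))

  ≤-respʳ : ∀ {x y z} → x ≈ y → z ≤ x → z ≤ y
  ≤-respʳ x≈y z≤x = trans z≤x (reflexive x≈y)

  _⊏_ : Rel Carrier 0ℓ
  x ⊏ y = x ≤ y × ¬ (y ≤ x)

  private
    ⊏-isStrictPartialOrder : IsStrictPartialOrder _≡_ (_⊏_ on enum)
    ⊏-isStrictPartialOrder = record
      { isEquivalence = ≡.isEquivalence
      ; irrefl        = λ { refl (p , ¬p) → ¬p p }
      ; trans         = λ (p , ¬p) (q , _) → trans p q , λ r → ¬p (trans q r)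
      ; <-resp-≈      = (λ { refl p → p }) , (λ { refl p → p })
      }

    ⊏-index : ∀ {x y} → x ⊏ y → enum (index x) ⊏ enum (index y)
    ⊏-index {x} {y} (x≤y , y≰x) =
        ≤-respˡ (Eq.sym (enum-index x)) (≤-respʳ (Eq.sym (enum-index y)) x≤y)
      , λ q → y≰x (≤-respˡ (enum-index y) (≤-respʳ (enum-index x) q))

  ⊏-wellFounded : WellFounded _⊏_
  ⊏-wellFounded = Subrelation.wellFounded ⊏-index
    (On.wellFounded index (spo-wellFounded ⊏-isStrictPartialOrder))

  ⊐-wellFounded : WellFounded (flip _⊏_)
  ⊐-wellFounded = Subrelation.wellFounded ⊏-index
    (On.wellFounded index (spo-noetherian ⊏-isStrictPartialOrder))

  minimal : ∀ {Q : Carrier → Set} → Q Respects _≈_ → Decidable Q → ∀ x → Q x →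
            ∃ λ m → m ≤ x × Q m × (∀ y → y ≤ m → Q y → m ≤ y)
  minimal {Q} resp Q? x q = go x q (⊏-wellFounded x)
    where
    go : ∀ x → Q x → Acc _⊏_ x → ∃ λ m → m ≤ x × Q m × (∀ y → y ≤ m → Q y → m ≤ y)
    go x q (acc rec)
      with ∃? (λ y≈z (q , y≤x , x≰y) → resp y≈z q , ≤-respˡ y≈z y≤x ,
                 λ x≤z → x≰y (≤-respʳ (Eq.sym y≈z) x≤z))
              (λ y → Q? y ×-dec y ≤? x ×-dec ¬? (x ≤? y))
    ... | yes (y , qy , y⊏x) with go y qy (rec y⊏x)
    ...   | m , m≤y , min = m , trans m≤y (proj₁ y⊏x) , min
    go x q (acc rec) | no none =
      x , ≤-refl , q , λ y y≤x qy → decidable-stable (x ≤? y) λ x≰y → none (y , qy , y≤x , x≰y)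

  -- The bottom element satisfies this condition; where it must be excluded, this is stated
  -- separately.
  JoinPrime : Carrier → Set
  JoinPrime p = ∀ x y → p ≤ x ∨ y → p ≤ x ⊎ p ≤ y

  -- A minimal element of {y | y ≰ c} is join prime.
  joinPrime-below : ∀ x c → ¬ (x ≤ c) →
    ∃ λ j → j ≤ x × ¬ (j ≤ c) × JoinPrime j × (∀ y → y ≤ j → y ≤ c ⊎ j ≤ y)
  joinPrime-below x c x≰c
    with minimal {Q = λ y → ¬ (y ≤ c)} (λ y≈z y≰c z≤c → y≰c (≤-respˡ (Eq.sym y≈z) z≤c))
           (λ y → ¬? (y ≤? c)) x x≰c
  ... | j , j≤x , j≰c , min = j , j≤x , j≰c , prime , below
    where
    below : ∀ y → y ≤ j → y ≤ c ⊎ j ≤ y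
    below y y≤j with y ≤? c
    ... | yes y≤c = inj₁ y≤c
    ... | no y≰c  = inj₂ (min y y≤j y≰c)

    prime : JoinPrime j
    prime u v j≤u∨v with below (j ∧ u) (x∧y≤x j u) | below (j ∧ v) (x∧y≤x j v)
    ... | inj₂ j≤j∧u | _          = inj₁ (trans j≤j∧u (x∧y≤y j u))
    ... | _          | inj₂ j≤j∧v = inj₂ (trans j≤j∧v (x∧y≤y j v))
    ... | inj₁ j∧u≤c | inj₁ j∧v≤c = ⊥-elim (j≰c
      (trans (∧-greatest ≤-refl j≤u∨v)
        (trans (∧-distribˡ-∨-≤ j u v) (∨-least j∧u≤c j∧v≤c))))

-- A, with a new join prime placed directly above c: the elements above c are doubled.
module Doubling (A : HA) (finite : Finite A) (c : HeytingAlgebra.Carrier A) where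
  open HeytingAlgebra A renaming (refl to ≤-refl)
  open FiniteHeyting A finite

  record Double : Set where
    constructor _,_by_
    field
      base : Carrier
      flag : Bool
      c≤   : T flag → c ≤ base
  open Double

  _≤ᴰ_ : Rel Double 0ℓ
  a ≤ᴰ b = base a ≤ base b × (T (flag a) → T (flag b))

  -- Equality is read off from the order, so that the proofs stored in `c≤` do not count.
  _≈ᴰ_ : Rel Double 0ℓ
  a ≈ᴰ b = a ≤ᴰ b × b ≤ᴰ a

  private
    module T∧ a b = Equivalence (T-∧ {flag a} {flag b})
    module T∨ a b = Equivalence (T-∨ {flag a} {flag b})

    -- The largest element whose meet with `a` is below `b` has base `base a ⇨ base b`. It carries
    -- the flag exactly when that base lies above `c` and a flag on `a` forces one on `b`.
    residual : Double → Double → Set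
    residual a b = c ≤ base a ⇨ base b × (T (flag a) → T (flag b))

    residual? : ∀ a b → Dec (residual a b)
    residual? a b = (c ≤? base a ⇨ base b) ×-dec (T? (flag a) →-dec T? (flag b))

    ≤ᴰ-refl : ∀ a → a ≤ᴰ a
    ≤ᴰ-refl a = ≤-refl , id

    ≤ᴰ-trans : ∀ a b d → a ≤ᴰ b → b ≤ᴰ d → a ≤ᴰ d
    ≤ᴰ-trans _ _ _ (p , f) (q , g) = trans p q , g ∘ f

  double : HA
  double = record
    { Carrier = Double
    ; _≈_     = _≈ᴰ_
    ; _≤_     = _≤ᴰ_
    ; _∨_     = λ a b → (base a ∨ base b) , (flag a Bool.∨ flag b) by
                  ([ (λ t → trans (c≤ a t) (x≤x∨y _ _)) , (λ t → trans (c≤ b t) (y≤x∨y _ _)) ]′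
                    ∘ T∨.to a b)
    ; _∧_     = λ a b → (base a ∧ base b) , (flag a Bool.∧ flag b) by
                  λ t → ∧-greatest (c≤ a (proj₁ (T∧.to a b t))) (c≤ b (proj₂ (T∧.to a b t)))
    ; _⇨_     = λ a b → (base a ⇨ base b) , ⌊ residual? a b ⌋ by
                  λ t → proj₁ (toWitness {a? = residual? a b} t)
    ; ⊤       = ⊤ , true by λ _ → maximum c
    -- Unflagged even if `c` is the bottom of `A`, so that the new join prime is never the bottom of
    -- the doubled algebra.
    ; ⊥       = ⊥ , false by λ ()
    ; isHeytingAlgebra = record
      { isBoundedLattice = record
        { isLattice = record
          { isPartialOrder = record
            { isPreorder = record
              { isEquivalence = record
                { refl  = λ {a} → ≤ᴰ-refl a , ≤ᴰ-refl a
                ; sym   = λ (p , q) → q , p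
                ; trans = λ {a} {b} {d} (p , p′) (q , q′) →
                    ≤ᴰ-trans a b d p q , ≤ᴰ-trans d b a q′ p′
                }
              ; reflexive = proj₁
              ; trans     = λ {a} {b} {d} → ≤ᴰ-trans a b d
              }
            ; antisym = _,_
            }
          ; supremum = λ a b →
                (x≤x∨y _ _ , T∨.from a b ∘ inj₁)
              , (y≤x∨y _ _ , T∨.from a b ∘ inj₂)
              , λ _ (p , f) (q , g) → ∨-least p q , [ f , g ]′ ∘ T∨.to a b
          ; infimum  = λ a b →
                (x∧y≤x _ _ , proj₁ ∘ T∧.to a b)
              , (x∧y≤y _ _ , proj₂ ∘ T∧.to a b)
              , λ _ (p , f) (q , g) → ∧-greatest p q , λ t → T∧.from a b (f t , g t)
          }
        ; maximum = λ a → maximum (base a) , _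
        ; minimum = λ a → minimum (base a) , λ ()
        }
      ; exponential = λ d a b →
          (λ (p , f) → transpose-⇨ p , λ t → fromWitness {a? = residual? a b}
            (trans (c≤ d t) (transpose-⇨ p) , λ s → f (T∧.from d a (t , s))))
        , (λ (p , f) → transpose-∧ p , λ t → let u , v = T∧.to d a t in
            proj₂ (toWitness {a? = residual? a b} (f u)) v)
      }
    }

  collapse : Hom double A
  collapse = base , record
    { cong  = λ (p , q) → antisym (proj₁ p) (proj₁ q)
    ; ∧-hom = λ _ _ → Eq.refl
    ; ∨-hom = λ _ _ → Eq.refl
    ; ⇨-hom = λ _ _ → Eq.refl
    ; ¬-hom = λ _ → Eq.refl
    ; ⊤-hom = Eq.refl
    ; ⊥-hom = Eq.refl
    }

  collapse-surjective : Surjective double A base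
  collapse-surjective x = (x , false by λ ()) , Eq.refl

  identity : Hom A A
  identity = id , record
    { cong  = id
    ; ∧-hom = λ _ _ → Eq.refl
    ; ∨-hom = λ _ _ → Eq.refl
    ; ⇨-hom = λ _ _ → Eq.refl
    ; ¬-hom = λ _ → Eq.refl
    ; ⊤-hom = Eq.refl
    ; ⊥-hom = Eq.refl
    }

  -- A section of the collapse singles out the prime filter of the flagged elements; p is its
  -- least element.
  joinPrime-above : Projective A → ∃ λ p →
    c ≤ p × JoinPrime p × ¬ (p ≤ ⊥) × (∀ x → x ≤ p → p ≤ x ⊎ x ≤ c)
  joinPrime-above projective
    with projective double A collapse collapse-surjective identity
  ... | (s , isHom) , section
    with minimal {Q = λ x → T (flag (s x))} (λ x≈y → proj₂ (proj₁ (IsHom.cong isHom x≈y)))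
           (λ x → T? (flag (s x))) ⊤ (proj₂ (proj₂ (IsHom.⊤-hom isHom)) tt)
  ... | p , _ , Fp , min = p , ≤-respʳ (section p) (c≤ (s p) Fp) , prime , p≰⊥ , above
    where
    open IsHom isHom renaming (cong to s-cong)

    F : Carrier → Set
    F x = T (flag (s x))

    F⇒p≤ : ∀ {x} → F x → p ≤ x
    F⇒p≤ {x} Fx = trans
      (min (p ∧ x) (x∧y≤x p x) (proj₂ (proj₂ (∧-hom p x)) (T∧.from (s p) (s x) (Fp , Fx))))
      (x∧y≤y p x)

    p≤⇒F : ∀ {x} → p ≤ x → F x
    p≤⇒F {x} p≤x = proj₂ (T∧.to (s p) (s x) (proj₂ (proj₁ (∧-hom p x))
      (proj₂ (proj₁ (s-cong (antisym (∧-greatest ≤-refl p≤x) (x∧y≤x p x)))) Fp)))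

    prime : JoinPrime p
    prime x y p≤x∨y with T∨.to (s x) (s y) (proj₂ (proj₁ (∨-hom x y)) (p≤⇒F p≤x∨y))
    ... | inj₁ Fx = inj₁ (F⇒p≤ Fx)
    ... | inj₂ Fy = inj₂ (F⇒p≤ Fy)

    p≰⊥ : ¬ (p ≤ ⊥)
    p≰⊥ p≤⊥ = proj₂ (proj₁ ⊥-hom) (p≤⇒F p≤⊥)

    above : ∀ x → x ≤ p → p ≤ x ⊎ x ≤ c
    above x x≤p with T? (flag (s x))
    ... | yes Fx = inj₁ (F⇒p≤ Fx)
    -- If `x` is unflagged, the flag condition for `s x ⇨ s c` holds vacuously, and its base is
    -- above `c` because `s c` has base `c`. Hence `x ⇨ c` is in the filter, so `p ≤ x ⇨ c`, and
    -- `x ≤ p` gives `x ≤ c`.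
    ... | no ¬Fx = inj₂ (trans (∧-greatest x≤p ≤-refl) (transpose-∧ (F⇒p≤
      (proj₂ (proj₂ (⇨-hom x c)) (fromWitness {a? = residual? (s x) (s c)}
        ( transpose-⇨ (trans (x∧y≤x _ _) (reflexive (Eq.sym (section c))))
        , λ Fx → ⊥-elim (¬Fx Fx)))))))

-- Join primes and the ordinal sum decomposition

module ProjectiveStructure (A : HA) (finite : Finite A) (projective : Projective A) where
  open HeytingAlgebra A renaming (refl to ≤-refl)
  open FiniteHeyting A finite

  private
    joinPrime-above : ∀ c → ∃ λ p →
      c ≤ p × JoinPrime p × ¬ (p ≤ ⊥) × (∀ x → x ≤ p → p ≤ x ⊎ x ≤ c)
    joinPrime-above c = Doubling.joinPrime-above A finite c projective

  ⊤≰⊥ : ¬ (⊤ ≤ ⊥)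
  ⊤≰⊥ ⊤≤⊥ with joinPrime-above ⊤
  ... | p , _ , _ , p≰⊥ , _ = p≰⊥ (trans (maximum p) ⊤≤⊥)

  -- The join prime provided above `⊤` can only be `⊤` itself.
  ⊤-joinPrime : JoinPrime ⊤
  ⊤-joinPrime x y ⊤≤x∨y with joinPrime-above ⊤
  ... | p , ⊤≤p , prime , _ with prime x y (trans (maximum p) ⊤≤x∨y)
  ...   | inj₁ p≤x = inj₁ (trans ⊤≤p p≤x)
  ...   | inj₂ p≤y = inj₂ (trans ⊤≤p p≤y)

  infix 4 _∥_

  _∥_ : Rel Carrier 0ℓ
  x ∥ y = ¬ (x ≤ y) × ¬ (y ≤ x)

  -- As in the Rieger–Nishimura ladder, a chain x < z of elements incomparable to y produces
  -- another such configuration p < r, q further up, where p, q, r are join primes directly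
  -- above x ∨ y, z ∨ y and p ∨ z.
  no-ladder : ∀ {x y z} → JoinPrime z → x ≤ z → ¬ (z ≤ x) → z ∥ y → ¬ (x ∥ y)
  no-ladder {x} = go (⊐-wellFounded x)
    where
    go : ∀ {x y z} → Acc (flip _⊏_) x → JoinPrime z →
         x ≤ z → ¬ (z ≤ x) → z ∥ y → ¬ (x ∥ y)
    go {x} {y} {z} (acc rec) z-prime x≤z z≰x (z≰y , y≰z) (x≰y , y≰x)
      with joinPrime-above (x ∨ y) | joinPrime-above (z ∨ y)
    ... | p , x∨y≤p , p-prime , _ , p-above | q , z∨y≤q , q-prime , _ , q-above
      with joinPrime-above (p ∨ z)
    ... | r , p∨z≤r , r-prime , _ , r-above =
      -- The ladder climbs strictly: `p` is also above `y`, so it is not below `x`. Finiteness then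
      -- ends the recursion.
      go (rec (x≤p , λ p≤x → y≰x (trans y≤p p≤x))) r-prime p≤r r≰p (r≰q , q≰r) (p≰q , q≰p)
      where
      x≤p = trans (x≤x∨y x y) x∨y≤p
      y≤p = trans (y≤x∨y x y) x∨y≤p
      z≤q = trans (x≤x∨y z y) z∨y≤q
      y≤q = trans (y≤x∨y z y) z∨y≤q
      p≤r = trans (x≤x∨y p z) p∨z≤r
      z≤r = trans (y≤x∨y p z) p∨z≤r

      -- As `p` is directly above `x ∨ y`, having `z ≤ p` would give `p ≤ z`, hence `y ≤ z`, or
      -- `z ≤ x ∨ y`, where primeness puts `z` below `x` or `y`.
      z≰p : ¬ (z ≤ p)
      z≰p z≤p with p-above z z≤p
      ... | inj₁ p≤z   = y≰z (trans y≤p p≤z)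
      ... | inj₂ z≤x∨y = [ z≰x , z≰y ]′ (z-prime x y z≤x∨y)

      q≰p : ¬ (q ≤ p)
      q≰p q≤p = z≰p (trans z≤q q≤p)

      p≰q : ¬ (p ≤ q)
      p≰q p≤q with q-above p p≤q
      ... | inj₁ q≤p   = q≰p q≤p
      ... | inj₂ p≤z∨y =
        [ (λ p≤z → y≰z (trans y≤p p≤z)) , (λ p≤y → x≰y (trans x≤p p≤y)) ]′ (p-prime z y p≤z∨y)

      r≰p : ¬ (r ≤ p)
      r≰p r≤p = z≰p (trans z≤r r≤p)

      r≰q : ¬ (r ≤ q)
      r≰q r≤q = p≰q (trans p≤r r≤q)

      q≰r : ¬ (q ≤ r)
      q≰r q≤r with r-above q q≤r
      ... | inj₁ r≤q   = r≰q r≤q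
      ... | inj₂ q≤p∨z = [ q≰p , (λ q≤z → y≰z (trans y≤q q≤z)) ]′ (q-prime p z q≤p∨z)

  -- A join prime `p` directly above `x ∨ y` would be incomparable to `z`, and the chain `x < p`
  -- beside `z` would start a ladder.
  no-three-antichain : ∀ {x y z} → JoinPrime z → x ∥ y → z ∥ x → ¬ (z ∥ y)
  no-three-antichain {x} {y} {z} z-prime (x≰y , y≰x) (z≰x , x≰z) (z≰y , y≰z)
    with joinPrime-above (x ∨ y)
  ... | p , x∨y≤p , p-prime , _ , p-above =
    no-ladder p-prime x≤p (λ p≤x → y≰x (trans (trans (y≤x∨y x y) x∨y≤p) p≤x))
      ((λ p≤z → x≰z (trans x≤p p≤z)) , z≰p) (x≰z , z≰x)
    where
    x≤p = trans (x≤x∨y x y) x∨y≤p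

    z≰p : ¬ (z ≤ p)
    z≰p z≤p with p-above z z≤p
    ... | inj₁ p≤z   = x≰z (trans x≤p p≤z)
    ... | inj₂ z≤x∨y = [ z≰x , z≰y ]′ (z-prime x y z≤x∨y)

  -- Otherwise either `x < z` is a chain beside `y`, which starts a ladder, or `x`, `y`, `z` form an
  -- antichain.
  unique-partner : ∀ {x y z} → JoinPrime z → x ∥ y → z ∥ y → z ≤ x
  unique-partner {x} {y} {z} z-prime x∥y z∥y with z ≤? x
  ... | yes z≤x = z≤x
  ... | no z≰x with x ≤? z
  ...   | yes x≤z = ⊥-elim (no-ladder z-prime x≤z z≰x z∥y x∥y)
  ...   | no x≰z  = ⊥-elim (no-three-antichain z-prime x∥y (z≰x , x≰z) z∥y)

  -- Nodes are the points at which the algebra can be cut into an ordinal sum.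
  Node : Carrier → Set
  Node c = ∀ y → y ≤ c ⊎ c ≤ y

  -- The interval above c is the ordinal sum described by the word.
  data Shape (c : Carrier) : Word → Set where
    end : ⊤ ≤ c → Shape c []
    one : ∀ {d w} → c ≤ d → ¬ (d ≤ c) → (∀ y → y ≤ c ⊎ d ≤ y) → Shape d w → Shape c (one ∷ w)
    two : ∀ {a b w} → c ≤ a → c ≤ b → a ∥ b →
          (∀ y → y ≤ c ⊎ y ≈ a ⊎ y ≈ b ⊎ a ∨ b ≤ y) → Shape (a ∨ b) w → Shape c (two ∷ w)

  -- For a node `c`, these are atoms of the interval above `c` that are join prime in the whole
  -- algebra.
  Atom : Carrier → Carrier → Set
  Atom c a = ¬ (a ≤ c) × JoinPrime a × (∀ y → y ≤ a → y ≤ c ⊎ a ≤ y)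

  atom-above : ∀ {c a} → Node c → Atom c a → c ≤ a
  atom-above {a = a} node (a≰c , _) = [ ⊥-elim ∘ a≰c , id ]′ (node a)

  -- If `y` were not below `a`, some join prime `j ≤ y` would not be below `a` either. It would be
  -- incomparable to `b`, just as `a` is, and `unique-partner` would give `j ≤ a`.
  below-atom : ∀ {c a b y} → Node c → Atom c a → Atom c b → a ∥ b → ¬ (b ≤ y) → y ≤ c ⊎ y ≈ a
  below-atom {c} {a} {b} {y} node a-atom b-atom a∥b b≰y with y ≤? a
  ... | yes y≤a = [ inj₁ , inj₂ ∘ antisym y≤a ]′ (proj₂ (proj₂ a-atom) y y≤a)
  ... | no y≰a with joinPrime-below y a y≰a
  ...   | j , j≤y , j≰a , j-prime , _ = ⊥-elim (j≰a (unique-partner j-prime a∥b (j≰b , b≰j)))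
    where
    b≰j : ¬ (b ≤ j)
    b≰j b≤j = b≰y (trans b≤j j≤y)

    j≰b : ¬ (j ≤ b)
    j≰b j≤b with proj₂ (proj₂ b-atom) j j≤b
    ... | inj₁ j≤c = j≰a (trans j≤c (atom-above node a-atom))
    ... | inj₂ b≤j = b≰j b≤j

  -- One summand is split off above the node `c`, starting from an atom `a`. If everything not below
  -- `c` is above `a`, the summand has two elements and `a` is the next node. Otherwise a
  -- counterexample `x` has a second atom `b` below it, and `a ∨ b` is the next node.
  shape : ∀ c → Acc (flip _⊏_) c → Node c → ¬ (⊤ ≤ c) → ∃₂ λ n ns → Shape c (word n ns)
  shape c (acc rec) node ⊤≰c with joinPrime-below ⊤ c ⊤≰c
  ... | a , _ , a-atom@(a≰c , _)
    with ∃? {Q = λ x → ¬ (x ≤ c) × ¬ (a ≤ x)}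
           (λ x≈y (x≰c , a≰x) → x≰c ∘ ≤-respˡ (Eq.sym x≈y) , a≰x ∘ ≤-respʳ (Eq.sym x≈y))
           (λ x → ¬? (x ≤? c) ×-dec ¬? (a ≤? x))
  shape c (acc rec) node ⊤≰c | a , _ , a-atom@(a≰c , _) | no none = result (⊤ ≤? a)
    where
    c≤a = atom-above node a-atom

    cover : ∀ y → y ≤ c ⊎ a ≤ y
    cover y with y ≤? c
    ... | yes y≤c = inj₁ y≤c
    ... | no y≰c  = inj₂ (decidable-stable (a ≤? y) λ a≰y → none (y , y≰c , a≰y))

    a-node : Node a
    a-node y = [ (λ y≤c → inj₁ (trans y≤c c≤a)) , inj₂ ]′ (cover y)

    result : Dec (⊤ ≤ a) → ∃₂ λ n ns → Shape c (word n ns)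
    result (yes ⊤≤a) = 0 , [] , one c≤a a≰c cover (end ⊤≤a)
    result (no ⊤≰a) with shape a (rec (c≤a , a≰c)) a-node ⊤≰a
    -- A letter `one` closes a block with no letter `two` so far, and the count found above `a`
    -- becomes the next entry.
    ... | n , ns , s = 0 , n ∷ ns , one c≤a a≰c cover s
  shape c (acc rec) node ⊤≰c | a , _ , a-atom@(a≰c , _ , a-min) | yes (x , x≰c , a≰x)
    with joinPrime-below x c x≰c
  ... | b , b≤x , b-atom@(b≰c , _) = result
    where
    c≤a = atom-above node a-atom
    c≤a∨b = trans c≤a (x≤x∨y a b)
    a∨b≰c = a≰c ∘ trans (x≤x∨y a b)

    a≰b : ¬ (a ≤ b)
    a≰b a≤b = a≰x (trans a≤b b≤x)

    b≰a : ¬ (b ≤ a)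
    b≰a b≤a = [ b≰c , a≰b ]′ (a-min b b≤a)

    cover : ∀ y → y ≤ c ⊎ y ≈ a ⊎ y ≈ b ⊎ a ∨ b ≤ y
    cover y with a ≤? y | b ≤? y
    ... | yes a≤y | yes b≤y = inj₂ (inj₂ (inj₂ (∨-least a≤y b≤y)))
    ... | _       | no b≰y  =
      [ inj₁ , inj₂ ∘ inj₁ ]′ (below-atom node a-atom b-atom (a≰b , b≰a) b≰y)
    ... | no a≰y  | _       =
      [ inj₁ , inj₂ ∘ inj₂ ∘ inj₁ ]′ (below-atom node b-atom a-atom (b≰a , a≰b) a≰y)

    a∨b-node : Node (a ∨ b)
    a∨b-node y with cover y
    ... | inj₁ y≤c                 = inj₁ (trans y≤c c≤a∨b)
    ... | inj₂ (inj₁ y≈a)          = inj₁ (≤-respˡ (Eq.sym y≈a) (x≤x∨y a b))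
    ... | inj₂ (inj₂ (inj₁ y≈b))   = inj₁ (≤-respˡ (Eq.sym y≈b) (y≤x∨y a b))
    ... | inj₂ (inj₂ (inj₂ a∨b≤y)) = inj₂ a∨b≤y

    -- Since `⊤` is join prime, it is not the join of two incomparable elements. So a four-element
    -- summand is never the last one, and the word ends in `one`.
    ⊤≰a∨b : ¬ (⊤ ≤ a ∨ b)
    ⊤≰a∨b ⊤≤a∨b =
      [ (λ ⊤≤a → b≰a (trans (maximum b) ⊤≤a)) , (λ ⊤≤b → a≰b (trans (maximum a) ⊤≤b)) ]′
        (⊤-joinPrime a b ⊤≤a∨b)

    result : ∃₂ λ n ns → Shape c (word n ns)
    result with shape (a ∨ b) (rec (c≤a∨b , a∨b≰c)) a∨b-node ⊤≰a∨b
    ... | n , ns , s = suc n , ns , two c≤a (atom-above node b-atom) (a≰b , b≰a) cover s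

  ⟦_⟧ : ∀ {c w} → Shape c w → Tower w → Carrier
  ⟦_⟧ {c} (end _)                 _      = c
  ⟦_⟧ {c} (one _ _ _ s)           bot    = c
  ⟦_⟧     (one _ _ _ s)           (up t) = ⟦ s ⟧ t
  ⟦_⟧ {c} (two _ _ _ _ s)         bot    = c
  ⟦_⟧     (two {a = a} _ _ _ _ s) lft    = a
  ⟦_⟧     (two {b = b} _ _ _ _ s) rgt    = b
  ⟦_⟧     (two _ _ _ _ s)         (up t) = ⟦ s ⟧ t

  c≤⟦_⟧ : ∀ {c w} (s : Shape c w) t → c ≤ ⟦ s ⟧ t
  c≤⟦ end _ ⟧           _      = ≤-refl
  c≤⟦ one _ _ _ _ ⟧     bot    = ≤-refl
  c≤⟦ one c≤d _ _ s ⟧   (up t) = trans c≤d (c≤⟦ s ⟧ t)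
  c≤⟦ two _ _ _ _ _ ⟧   bot    = ≤-refl
  c≤⟦ two c≤a _ _ _ _ ⟧ lft    = c≤a
  c≤⟦ two _ c≤b _ _ _ ⟧ rgt    = c≤b
  c≤⟦ two c≤a _ _ _ s ⟧ (up t) = trans c≤a (trans (x≤x∨y _ _) (c≤⟦ s ⟧ t))

  ⟦⟧-mono : ∀ {c w} (s : Shape c w) {t u} → t ≤ᵀ u → ⟦ s ⟧ t ≤ ⟦ s ⟧ u
  ⟦⟧-mono (end _)         _                = ≤-refl
  ⟦⟧-mono s@(one _ _ _ _)   {u = u} bot≤   = c≤⟦ s ⟧ u
  ⟦⟧-mono (one _ _ _ s)   (up≤up p)        = ⟦⟧-mono s p
  ⟦⟧-mono s@(two _ _ _ _ _) {u = u} bot≤   = c≤⟦ s ⟧ u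
  ⟦⟧-mono (two _ _ _ _ _) lft≤lft          = ≤-refl
  ⟦⟧-mono (two _ _ _ _ _) rgt≤rgt          = ≤-refl
  ⟦⟧-mono (two _ _ _ _ s) (lft≤up {x = t}) = trans (x≤x∨y _ _) (c≤⟦ s ⟧ t)
  ⟦⟧-mono (two _ _ _ _ s) (rgt≤up {x = t}) = trans (y≤x∨y _ _) (c≤⟦ s ⟧ t)
  ⟦⟧-mono (two _ _ _ _ s) (up≤up p)        = ⟦⟧-mono s p

  ⟦⟧-reflects : ∀ {c w} (s : Shape c w) t u → ⟦ s ⟧ t ≤ ⟦ s ⟧ u → t ≤ᵀ u
  ⟦⟧-reflects (end _)         top    top    _ = top≤top
  ⟦⟧-reflects (one _ _ _ _)   bot    _      _ = bot≤
  ⟦⟧-reflects (one _ d≰c _ s) (up t) bot    p = ⊥-elim (d≰c (trans (c≤⟦ s ⟧ t) p))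
  ⟦⟧-reflects (one _ _ _ s)   (up t) (up u) p = up≤up (⟦⟧-reflects s t u p)
  ⟦⟧-reflects (two _ _ _ _ _) bot    _      _ = bot≤
  ⟦⟧-reflects (two _ _ _ _ _) lft    lft    _ = lft≤lft
  ⟦⟧-reflects (two _ _ _ _ _) rgt    rgt    _ = rgt≤rgt
  ⟦⟧-reflects (two _ _ _ _ _) lft    (up _) _ = lft≤up
  ⟦⟧-reflects (two _ _ _ _ _) rgt    (up _) _ = rgt≤up
  ⟦⟧-reflects (two _ _ _ _ s) (up t) (up u) p = up≤up (⟦⟧-reflects s t u p)
  ⟦⟧-reflects (two _ c≤b (a≰b , _) _ _) lft bot p = ⊥-elim (a≰b (trans p c≤b))
  ⟦⟧-reflects (two _ _ (a≰b , _) _ _)   lft rgt p = ⊥-elim (a≰b p)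
  ⟦⟧-reflects (two c≤a _ (_ , b≰a) _ _) rgt bot p = ⊥-elim (b≰a (trans p c≤a))
  ⟦⟧-reflects (two _ _ (_ , b≰a) _ _)   rgt lft p = ⊥-elim (b≰a p)
  ⟦⟧-reflects (two _ c≤b (a≰b , _) _ s) (up t) bot p =
    ⊥-elim (a≰b (trans (x≤x∨y _ _) (trans (c≤⟦ s ⟧ t) (trans p c≤b))))
  ⟦⟧-reflects (two _ _ (_ , b≰a) _ s)   (up t) lft p =
    ⊥-elim (b≰a (trans (y≤x∨y _ _) (trans (c≤⟦ s ⟧ t) p)))
  ⟦⟧-reflects (two _ _ (a≰b , _) _ s)   (up t) rgt p =
    ⊥-elim (a≰b (trans (x≤x∨y _ _) (trans (c≤⟦ s ⟧ t) p)))

  ⟦⟧-surjective : ∀ {c w} (s : Shape c w) y → c ≤ y → ∃ λ t → ⟦ s ⟧ t ≈ y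
  ⟦⟧-surjective (end ⊤≤c) y c≤y = top , antisym c≤y (trans (maximum y) ⊤≤c)
  ⟦⟧-surjective (one _ _ cover s) y c≤y with cover y
  ... | inj₁ y≤c = bot , antisym c≤y y≤c
  ... | inj₂ d≤y = let t , eq = ⟦⟧-surjective s y d≤y in up t , eq
  ⟦⟧-surjective (two _ _ _ cover s) y c≤y with cover y
  ... | inj₁ y≤c                 = bot , antisym c≤y y≤c
  ... | inj₂ (inj₁ y≈a)          = lft , Eq.sym y≈a
  ... | inj₂ (inj₂ (inj₁ y≈b))   = rgt , Eq.sym y≈b
  ... | inj₂ (inj₂ (inj₂ a∨b≤y)) = let t , eq = ⟦⟧-surjective s y a∨b≤y in up t , eq

-- Embeddings, order isomorphisms and subalgebras

Embedding : HA → HA → Set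
Embedding A B = Σ (Hom A B) λ f → ∀ x y → proj₁ f x B.≈ proj₁ f y → x A.≈ y
  where
  module A = HeytingAlgebra A
  module B = HeytingAlgebra B

-- The Heyting operations are determined by the order, so a surjection that preserves and reflects
-- the order is an isomorphism of Heyting algebras.
record OrderIsomorphism (A B : HA) : Set where
  private
    module A = HeytingAlgebra A
    module B = HeytingAlgebra B
  field
    to         : A.Carrier → B.Carrier
    mono       : ∀ {x y} → x A.≤ y → to x B.≤ to y
    reflects   : ∀ {x y} → to x B.≤ to y → x A.≤ y
    surjective : Surjective A B to

  private
    -- An element is determined by its lower bounds, and by surjectivity it is enough to test these
    -- on images.
    above : ∀ {y z} → (∀ x → to x B.≤ y → to x B.≤ z) → y B.≤ z
    above {y} h = let x , eq = surjective y in
      B.trans (B.reflexive (B.Eq.sym eq)) (h x (B.reflexive eq))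

    below : ∀ {y z} → (∀ x → y B.≤ to x → z B.≤ to x) → z B.≤ y
    below {y} h = let x , eq = surjective y in
      B.trans (h x (B.reflexive (B.Eq.sym eq))) (B.reflexive eq)

    ∧-hom : ∀ x y → to (x A.∧ y) B.≈ to x B.∧ to y
    ∧-hom x y = B.antisym
      (B.∧-greatest (mono (A.x∧y≤x x y)) (mono (A.x∧y≤y x y)))
      (above λ z p → mono (A.∧-greatest (reflects (B.trans p (B.x∧y≤x _ _)))
                                        (reflects (B.trans p (B.x∧y≤y _ _)))))

    ∨-hom : ∀ x y → to (x A.∨ y) B.≈ to x B.∨ to y
    ∨-hom x y = B.antisym
      (below λ z p → mono (A.∨-least (reflects (B.trans (B.x≤x∨y _ _) p))
                                     (reflects (B.trans (B.y≤x∨y _ _) p))))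
      (B.∨-least (mono (A.x≤x∨y x y)) (mono (A.y≤x∨y x y)))

    ⇨-hom : ∀ x y → to (x A.⇨ y) B.≈ to x B.⇨ to y
    ⇨-hom x y = B.antisym
      (B.transpose-⇨ (B.trans (B.reflexive (B.Eq.sym (∧-hom _ x)))
        (mono (A.transpose-∧ A.refl))))
      (above λ z p → mono (A.transpose-⇨ (reflects
        (B.trans (B.reflexive (∧-hom z x)) (B.transpose-∧ p)))))

    ⊥-hom : to A.⊥ B.≈ B.⊥
    ⊥-hom = B.antisym (below λ x _ → mono (A.minimum x)) (B.minimum _)

  isHom : IsHom A B to
  isHom = record
    { cong  = λ x≈y → B.antisym (mono (A.reflexive x≈y)) (mono (A.reflexive (A.Eq.sym x≈y)))
    ; ∧-hom = ∧-hom
    ; ∨-hom = ∨-hom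
    ; ⇨-hom = ⇨-hom
    ; ¬-hom = λ x → B.Eq.trans (⇨-hom x A.⊥) (⇨-congʳ ⊥-hom)
    ; ⊤-hom = B.antisym (B.maximum _) (above λ x _ → mono (A.maximum x))
    ; ⊥-hom = ⊥-hom
    }
    where
    ⇨-congʳ : ∀ {x y z} → y B.≈ z → x B.⇨ y B.≈ x B.⇨ z
    ⇨-congʳ = HeytingProperties.⇨-cong B B.Eq.refl

  injective : ∀ x y → to x B.≈ to y → x A.≈ y
  injective x y eq =
    A.antisym (reflects (B.reflexive eq)) (reflects (B.reflexive (B.Eq.sym eq)))

  embedding : Embedding A B
  embedding = (to , isHom) , injective

embedding-trans : ∀ {A B C} → Embedding A B → Embedding B C → Embedding A C
embedding-trans {A} {B} {C} ((f , F) , f-inj) ((g , G) , g-inj) =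
  (g ∘ f , record
    { cong  = G.cong ∘ F.cong
    ; ∧-hom = λ x y → C.trans (G.cong (F.∧-hom x y)) (G.∧-hom _ _)
    ; ∨-hom = λ x y → C.trans (G.cong (F.∨-hom x y)) (G.∨-hom _ _)
    ; ⇨-hom = λ x y → C.trans (G.cong (F.⇨-hom x y)) (G.⇨-hom _ _)
    ; ¬-hom = λ x → C.trans (G.cong (F.¬-hom x)) (G.¬-hom _)
    ; ⊤-hom = C.trans (G.cong F.⊤-hom) G.⊤-hom
    ; ⊥-hom = C.trans (G.cong F.⊥-hom) G.⊥-hom
    }) , λ x y → f-inj x y ∘ g-inj (f x) (f y)
  where
  module F = IsHom F
  module G = IsHom G
  module C = HeytingAlgebra.Eq C

embedding⇒≲ : ∀ {A B} → Embedding A B → A ≲ B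
embedding⇒≲ {A} {B} ((f , isHom) , injective) = (λ y → ∃ λ x → f x ≈ y)
  , record
    { resp = λ { y≈z (x , p) → x , Eq.trans p y≈z }
    ; ∧-cl = λ { (x , p) (y , q) → x A.∧ y , Eq.trans (∧-hom x y) (∧-cong p q) }
    ; ∨-cl = λ { (x , p) (y , q) → x A.∨ y , Eq.trans (∨-hom x y) (∨-cong p q) }
    ; ⇨-cl = λ { (x , p) (y , q) → x A.⇨ y , Eq.trans (⇨-hom x y) (⇨-cong p q) }
    ; ¬-cl = λ { (x , p) → neg A x , Eq.trans (¬-hom x) (⇨-cong p Eq.refl) }
    ; ⊤-cl = A.⊤ , ⊤-hom
    ; ⊥-cl = A.⊥ , ⊥-hom
    }
  , (f , isHom) , (λ x → x , Eq.refl) , injective , (λ _ → id)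
  where
  module A = HeytingAlgebra A
  open HeytingAlgebra B
  open IsHom isHom hiding (cong)
  open HeytingProperties B using (⇨-cong)
  open JoinProperties joinSemilattice using (∨-cong)
  ∧-cong : ∀ {x y u v} → x ≈ y → u ≈ v → x ∧ u ≈ y ∧ v
  ∧-cong = JoinProperties.∨-cong (MeetProperties.dualJoinSemilattice meetSemilattice)

≲⇒embedding : ∀ {A B} → A ≲ B → Embedding A B
≲⇒embedding (_ , _ , f , _ , injective , _) = f , injective

≲-trans : ∀ {A B C} → A ≲ B → B ≲ C → A ≲ C
≲-trans {A} {B} {C} A≲B B≲C =
  embedding⇒≲ (embedding-trans {A} {B} {C} (≲⇒embedding {A} {B} A≲B) (≲⇒embedding {B} {C} B≲C))

-- Representation by towers and the well-quasi-order

module _ (A : HA) (finite : Finite A) (projective : Projective A) where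
  open HeytingAlgebra A
  open FiniteHeyting A finite
  open ProjectiveStructure A finite projective

  shape-embeddings : ∀ {w} → Shape ⊥ w → Embedding A (tower w) × Embedding (tower w) A
  shape-embeddings {w} s = OrderIsomorphism.embedding to , OrderIsomorphism.embedding from
    where
    inverse : Carrier → Tower w
    inverse y = proj₁ (⟦⟧-surjective s y (minimum y))

    ⟦inverse⟧ : ∀ y → ⟦ s ⟧ (inverse y) ≈ y
    ⟦inverse⟧ y = proj₂ (⟦⟧-surjective s y (minimum y))

    from : OrderIsomorphism (tower w) A
    from = record
      { to         = ⟦ s ⟧
      ; mono       = ⟦⟧-mono s
      ; reflects   = λ {t} {u} → ⟦⟧-reflects s t u
      ; surjective = λ y → inverse y , ⟦inverse⟧ y
      }

    to : OrderIsomorphism A (tower w)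
    to = record
      { to         = inverse
      ; mono       = λ {x} {y} x≤y → ⟦⟧-reflects s _ _
          (≤-respˡ (Eq.sym (⟦inverse⟧ x)) (≤-respʳ (Eq.sym (⟦inverse⟧ y)) x≤y))
      ; reflects   = λ {x} {y} p →
          ≤-respˡ (⟦inverse⟧ x) (≤-respʳ (⟦inverse⟧ y) (⟦⟧-mono s p))
      ; surjective = λ t →
          ⟦ s ⟧ t , OrderIsomorphism.injective from _ t (⟦inverse⟧ (⟦ s ⟧ t))
      }

  abstract
    representation : ∃₂ λ n ns →
      Embedding A (tower (word n ns)) × Embedding (tower (word n ns)) A
    -- The decomposition starts at `⊥`, a node because it is the minimum.
    representation with shape ⊥ (⊐-wellFounded ⊥) (inj₂ ∘ minimum) ⊤≰⊥
    ... | n , ns , s = n , ns , shape-embeddings s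

representative : P → ℕ × List ℕ
representative (A , finite , projective) =
  let n , ns , _ = representation A finite projective in n , ns

_≤ᴿ_ : Rel (ℕ × List ℕ) 0ℓ
(n , ns) ≤ᴿ (m , ms) = n ≤ⁿ m × ns ≤* ms

-- The embedding is the composite of `A` into its tower, that tower into the tower of `B`, and the
-- latter into `B`.
representative-reflects : ∀ X Y → representative X ≤ᴿ representative Y → X ≤P Y
representative-reflects (A , fA , pA) (B , fB , pB) (n≤m , ns≤ms)
  with representation A fA pA | representation B fB pB
... | n , ns , toTower , _ | m , ms , _ , fromTower =
  embedding⇒≲ {A} {B} (embedding-trans {A} {tower (word n ns)} {B} toTower
    (embedding-trans {tower (word n ns)} {tower (word m ms)} {B}
      ((embed e , embed-isHom e) , embed-injective e) fromTower))
  where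
  e = word-⊑ n≤m ns≤ms

abstract
  AF-≤ᴿ : AlmostFull _≤ᴿ_
  AF-≤ᴿ = AF-× AF-≤ AF-≤*

≤P-good-pair : ∀ (f : ℕ → P) → ∃₂ λ i j → i <ⁿ j × f i ≤P f j
≤P-good-pair f with good-pair AF-≤ᴿ (representative ∘ f)
... | i , j , i<j , p = i , j , i<j , representative-reflects (f i) (f j) p

theorem11 : WellQuasiOrdered _≤P_
theorem11 = no-descent , no-antichain
  where
  no-descent : ¬ Σ (ℕ → P) λ f → ∀ n → _<_ _≤P_ (f (suc n)) (f n)
  no-descent (f , descends) with ≤P-good-pair f
  ... | i , j , i<j , fi≤fj = proj₂ (descends i) (back (ℕ.≤⇒≤′ i<j) fi≤fj)
    where
    -- Transitivity along the descending sequence turns `f i ≤P f j` into `f i ≤P f (suc i)`, which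
    -- strictness of the step at `i` forbids.
    back : ∀ {k} → suc i ≤′ k → f i ≤P f k → f i ≤P f (suc i)
    back (≤′-reflexive refl)        p = p
    back {suc k} (≤′-step i<k) p =
      back i<k (≲-trans {proj₁ (f i)} {proj₁ (f (suc k))} {proj₁ (f k)} p (proj₁ (descends k)))

  no-antichain : ¬ Σ (ℕ → P) λ f → ∀ i j → i ≢ j → Incomparable _≤P_ (f i) (f j)
  no-antichain (f , incomparable) with ≤P-good-pair f
  ... | i , j , i<j , fi≤fj = proj₁ (incomparable i j (ℕ.<⇒≢ i<j)) fi≤fj
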